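{- For all $r,s,t,k\in\mathbb{N}$ with $r\geq 2$ there is a constant $C=C(r,s,t,k)$ such that: if $H=(V_1,\dots,V_r;E)$ is a semilinear $r$-partite $r$-uniform hypergraph of description complexity $(s,t)$ which is $K_{k,\dots,k}$-free, then $$|E|\leq C\, n^{r-1}\log^{s(2^{r-1}-1)}(n),$$ where $n=|V_1|+\dots+|V_r|$.
   Context: All $V_i$ are finite. A set $X\subseteq\mathbb{R}^d$ is semilinear of description complexity $(s,t)$ if it is a union of at most $t$ sets of the form $\{x\in\mathbb{R}^d: f_1(x)\le 0,\dots,f_p(x)\le 0, f_{p+1}(x)<0,\dots,f_s(x)<0\}$ with $p\le s$ and each $f_i(x_1,\dots,x_d)=\lambda_1x_1+\dots+\lambda_dx_d+a$ an affine function with real coefficients. An $r$-partite $r$-uniform hypergraph $H=(V_1,\dots,V_r;E)$ (with $E\subseteq V_1\times\dots\times V_r$) is semilinear of description complexity $(s,t)$ if there are $d_i\in\mathbb{N}$, sets $V_i'\subseteq\mathbb{R}^{d_i}$ and a semilinear set $X\subseteq\prod_{i\in[r]}\mathbb{R}^{d_i}$ of description complexity $(s,t)$ such that $H$ is isomorphic to $(V_1',\dots,V_r';X\cap\prod_i V_i')$. $H$ is $K_{k,\dots,k}$-free if there are no $C_i\subseteq V_i$ with $|C_i|=k$ for all $i$ and $C_1\times\dots\times C_r\subseteq E$. -}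

module Defs where

open import Level using (0ℓ) renaming (suc to lsuc)
open import Data.Nat using (ℕ; zero; suc) renaming (_+_ to _+ℕ_; _≤_ to _≤ℕ_; _<_ to _<ℕ_)
open import Data.Fin using (Fin; zero; suc; toℕ)
open import Data.Bool using (Bool; true; false; if_then_else_)
open import Data.Product using (Σ; ∃; _×_; _,_)
open import Data.Sum using (_⊎_)
open import Relation.Nullary using (¬_)
open import Relation.Binary.PropositionalEquality using (_≡_)
open import Relation.Binary.Structures using (IsStrictTotalOrder)
open import Algebra.Bundles using (CommutativeRing)
open import Function using (_∘_; _⇔_)

record RealField : Set₁ where
  field
    commRing : CommutativeRing 0ℓ 0ℓ
  open CommutativeRing commRing public
  infix 4 _<_ _≤_
  field
    _<_                : Carrier → Carrier → Set
    isStrictTotalOrder : IsStrictTotalOrder _≈_ _<_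
    0≉1                : ¬ (0# ≈ 1#)
    inverse            : ∀ x → ¬ (x ≈ 0#) → ∃ λ y → x * y ≈ 1#
    +-mono-<           : ∀ {x y} z → x < y → x + z < y + z
    *-pos              : ∀ {x y} → 0# < x → 0# < y → 0# < x * y

  _≤_ : Carrier → Carrier → Set
  x ≤ y = x < y ⊎ x ≈ y

  field
    complete : (P : Carrier → Set) → ∃ P → (∃ λ b → ∀ x → P x → x ≤ b) →
               ∃ λ u → (∀ x → P x → x ≤ u) × (∀ b → (∀ x → P x → x ≤ b) → u ≤ b)

sumℕ : (m : ℕ) → (Fin m → ℕ) → ℕ
sumℕ zero    f = 0
sumℕ (suc m) f = f zero +ℕ sumℕ m (f ∘ suc)

Tuple : (r : ℕ) → (Fin r → ℕ) → Set
Tuple r n = (i : Fin r) → Fin (n i)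

record Hypergraph (r : ℕ) : Set where
  field
    size : Fin r → ℕ
    edge : Tuple r size → Bool
open Hypergraph public

consT : ∀ {r} {n : Fin (suc r) → ℕ} → Fin (n zero) → Tuple r (n ∘ suc) → Tuple (suc r) n
consT x g zero    = x
consT x g (suc i) = g i

countTrue : (r : ℕ) (n : Fin r → ℕ) → (Tuple r n → Bool) → ℕ
countTrue zero    n f = if f (λ ()) then 1 else 0
countTrue (suc r) n f = sumℕ (n zero) (λ x → countTrue r (n ∘ suc) (λ g → f (consT x g)))

numEdges : ∀ {r} → Hypergraph r → ℕ
numEdges {r} H = countTrue r (size H) (edge H)

numVertices : ∀ {r} → Hypergraph r → ℕ
numVertices {r} H = sumℕ r (size H)

-- K_{k,…,k}-freeness: no C_i ⊆ V_i with |C_i| = k (given as injections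
-- Fin k → V_i) such that C_1 × … × C_r ⊆ E.
KFree : ∀ {r} → ℕ → Hypergraph r → Set
KFree {r} k H =
  ¬ (Σ ((i : Fin r) → Fin k → Fin (size H i)) λ c →
       (∀ i (a b : Fin k) → c i a ≡ c i b → a ≡ b) ×
       (∀ (j : Fin r → Fin k) → edge H (λ i → c i (j i)) ≡ true))

module Semilinear (ℝ : RealField) where
  open RealField ℝ using (Carrier; _≈_; _+_; _*_; 0#; _<_; _≤_)

  sumR : (m : ℕ) → (Fin m → Carrier) → Carrier
  sumR zero    f = 0#
  sumR (suc m) f = f zero + sumR m (f ∘ suc)

  Point : (r : ℕ) → (Fin r → ℕ) → Set
  Point r d = (i : Fin r) → Fin (d i) → Carrier

  record Affine (r : ℕ) (d : Fin r → ℕ) : Set where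
    field
      coeff : (i : Fin r) → Fin (d i) → Carrier
      const : Carrier

  evalA : ∀ {r d} → Affine r d → Point r d → Carrier
  evalA {r} {d} f x =
    sumR r (λ i → sumR (d i) (λ j → Affine.coeff f i j * x i j)) + Affine.const f

  -- {x : f_1(x) ≤ 0, …, f_p(x) ≤ 0, f_{p+1}(x) < 0, …, f_s(x) < 0}
  record Basic (r : ℕ) (d : Fin r → ℕ) (s : ℕ) : Set where
    field
      p    : ℕ
      p≤s  : p ≤ℕ s
      fs   : Fin s → Affine r d

  inBasic : ∀ {r d s} → Basic r d s → Point r d → Set
  inBasic {s = s} B x =
    ∀ (j : Fin s) → (toℕ j <ℕ Basic.p B → evalA (Basic.fs B j) x ≤ 0#)
                  × (Basic.p B ≤ℕ toℕ j → evalA (Basic.fs B j) x < 0#)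

  record SemilinearSet (r : ℕ) (d : Fin r → ℕ) (s t : ℕ) : Set where
    field
      m      : ℕ
      m≤t    : m ≤ℕ t
      pieces : Fin m → Basic r d s

  inSL : ∀ {r d s t} → SemilinearSet r d s t → Point r d → Set
  inSL X x = ∃ λ j → inBasic (SemilinearSet.pieces X j) x

  -- H is isomorphic to (V_1',…,V_r'; X ∩ ∏ V_i') with V_i' ⊆ ℝ^{d_i}:
  -- injective embeddings φ_i : V_i → ℝ^{d_i} with e ∈ E ⇔ φ(e) ∈ X.
  IsSemilinear : ∀ {r} → (s t : ℕ) → Hypergraph r → Set
  IsSemilinear {r} s t H =
    Σ (Fin r → ℕ) λ d →
    Σ ((i : Fin r) → Fin (size H i) → Fin (d i) → Carrier) λ φ →
    Σ (SemilinearSet r d s t) λ X →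
      (∀ i (a b : Fin (size H i)) → (∀ j → φ i a j ≈ φ i b j) → a ≡ b) ×
      (∀ (v : Tuple r (size H)) → (edge H v ≡ true) ⇔ inSL X (λ i → φ i (v i)))

{-# OPTIONS --safe #-}
module Submission where

-- Induction on the number of parts.  For a tuple g of vertices from all parts but the first,
-- each half-space condition x ↦ p x g holds on an initial segment of the first part sorted
-- along p.  A dyadic decomposition of these segments writes the edge set as a disjoint union
-- of products V × G, where every vertex lies in at most log^s n of the sets V, every g in at
-- most log^s n of the sets G, and membership in G is given by 2s conditions: each condition p
-- yields p w and the negation of p w′ for two fixed vertices w, w′.  If |V| ≥ k, then G
-- contains no box of side k and induction applies with 2s conditions; the products with
-- |V| < k contribute at most k n^(r-1) log^s n.  Hence the exponents satisfy
-- e(r+1, s) = s + e(r, 2s), with e(1, s) = 0.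

open import Defs
open import Data.Bool as Bool using (Bool; true; false; if_then_else_; _∧_; not)
open import Data.Bool.ListAction using (all)
open import Data.Fin using (Fin; zero; suc; inject≤; toℕ)
open import Data.Fin.Properties using (inject≤-injective; ¬Fin0; all?; ¬∀⟶∃¬)
open import Data.List using (List; []; _∷_; [_]; _++_; map; length; filter; allFin; tabulate; lookup)
open import Data.List.Properties using (map-++; length-++; map-tabulate; length-tabulate)
open import Data.List.Membership.Propositional using (_∈_)
open import Data.List.Membership.Propositional.Properties using (∈-lookup; ∈-++⁻; ∈-++⁺ˡ; ∈-++⁺ʳ; ∈-filter⁻)
open import Data.List.Relation.Binary.Permutation.Propositional using (_↭_; ↭-refl; ↭-sym; ↭-trans; prep; swap; ↭⇒↭ₛ)
open import Data.List.Relation.Binary.Permutation.Propositional.Properties using (↭-length; map⁺; ∈-resp-↭; All-resp-↭)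
import Data.List.Relation.Binary.Permutation.Setoid.Properties as Permₛ
open import Data.List.Relation.Unary.All as All using (All; []; _∷_)
import Data.List.Relation.Unary.All.Properties as Allₚ
open import Data.List.Relation.Unary.AllPairs using (AllPairs; []; _∷_)
open import Data.List.Relation.Unary.Any using (here)
open import Data.List.Relation.Unary.Unique.Propositional using (Unique)
import Data.List.Relation.Unary.Unique.Propositional.Properties as Uniqueₚ
open import Data.Nat using (ℕ; zero; suc; _+_; _*_; _^_; _∸_; _≤_; _<_; z≤n; s≤s; s≤s⁻¹; _≤?_; _<?_; ⌊_/2⌋; ⌈_/2⌉; >-nonZero)
open import Data.Nat.ListAction using (sum)
open import Data.Nat.ListAction.Properties using (sum-++; sum-↭)
open import Data.Nat.Logarithm using (⌈log₂_⌉; ⌈log₂⌉-mono-≤; ⌈log₂⌈n/2⌉⌉≡⌈log₂n⌉∸1; ⌈log₂2^n⌉≡n)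
open import Data.Nat.Induction using (<-rec)
open import Data.Nat.Properties
open import Data.Nat.Solver using (module +-*-Solver)
open import Data.Product using (∃; _×_; _,_; proj₁; proj₂)
open import Data.Sum using (_⊎_; inj₁; inj₂; [_,_]′)
open import Data.Unit using (⊤; tt)
open import Function using (_∘_; id; Equivalence)
open import Relation.Binary.PropositionalEquality hiding ([_])
open import Relation.Nullary using (¬_; Dec; yes; no; does; contradiction)
open import Relation.Nullary.Decidable using (dec-true; _⊎-dec_)
open import Relation.Binary.Definitions using (tri<; tri≈; tri>)
open import Relation.Binary.Structures using (IsStrictTotalOrder)

-- Boolean predicates on tuples

Pred : (r : ℕ) → (Fin r → ℕ) → Set
Pred r n = Tuple r n → Bool

module _ {X : Set} where

  infix  4 _⊑_
  infixr 6 _∩_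

  _⊑_ : (X → Bool) → (X → Bool) → Set
  p ⊑ q = ∀ g → p g ≡ true → q g ≡ true

  _∩_ : (X → Bool) → (X → Bool) → (X → Bool)
  (p ∩ q) g = p g ∧ q g

  ∁ : (X → Bool) → (X → Bool)
  ∁ p g = not (p g)

  full : X → Bool
  full _ = true

  ⋂ : List (X → Bool) → (X → Bool)
  ⋂ ps g = all (λ p → p g) ps

  ∩-elim : ∀ p q g → (p ∩ q) g ≡ true → p g ≡ true × q g ≡ true
  ∩-elim p q g e with p g | q g
  ∩-elim p q g e | true | true = refl , refl

  ∩-intro : ∀ p q g → p g ≡ true → q g ≡ true → (p ∩ q) g ≡ true
  ∩-intro p q g e f rewrite e = f

  ∁-antitone : ∀ p q → p ⊑ q → ∁ q ⊑ ∁ p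
  ∁-antitone p q p⊑q g e with p g in eq
  ... | false = refl
  ... | true rewrite p⊑q g eq = e

  ∁-contra : ∀ p g → ∁ p g ≡ true → ¬ (p g ≡ true)
  ∁-contra p g e f rewrite f = contradiction e λ ()

section : ∀ {r n} → Pred (suc r) n → Fin (n zero) → Pred r (n ∘ suc)
section p x g = p (consT x g)

-- Counting tuples

count : ∀ {r n} → Pred r n → ℕ
count {r} {n} p = countTrue r n p

sumℕ-mono : ∀ m {f g : Fin m → ℕ} → (∀ i → f i ≤ g i) → sumℕ m f ≤ sumℕ m g
sumℕ-mono zero    f≤g = z≤n
sumℕ-mono (suc m) f≤g = +-mono-≤ (f≤g zero) (sumℕ-mono m (f≤g ∘ suc))

sumℕ-cong : ∀ m {f g : Fin m → ℕ} → (∀ i → f i ≡ g i) → sumℕ m f ≡ sumℕ m g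
sumℕ-cong zero    f≡g = refl
sumℕ-cong (suc m) f≡g = cong₂ _+_ (f≡g zero) (sumℕ-cong m (f≡g ∘ suc))

+-interchange : ∀ a b c d → (a + b) + (c + d) ≡ (a + c) + (b + d)
+-interchange = solve 4 (λ a b c d → (a :+ b) :+ (c :+ d) := (a :+ c) :+ (b :+ d)) refl
  where open +-*-Solver

sumℕ-+ : ∀ m (f g : Fin m → ℕ) → sumℕ m (λ i → f i + g i) ≡ sumℕ m f + sumℕ m g
sumℕ-+ zero    f g = refl
sumℕ-+ (suc m) f g = trans (cong (f zero + g zero +_) (sumℕ-+ m (f ∘ suc) (g ∘ suc)))
  (+-interchange (f zero) (g zero) _ _)

sumℕ≤* : ∀ m {f : Fin m → ℕ} b → (∀ i → f i ≤ b) → sumℕ m f ≤ m * b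
sumℕ≤* zero    b f≤b = z≤n
sumℕ≤* (suc m) b f≤b = +-mono-≤ (f≤b zero) (sumℕ≤* m b (f≤b ∘ suc))

-- Passes to lists of vertices: unlike sums over `Fin m`, sums over lists can be sorted and cut.
sumℕ≡sum : ∀ m (f : Fin m → ℕ) → sumℕ m f ≡ sum (map f (allFin m))
sumℕ≡sum m f = trans (go m f) (cong sum (sym (map-tabulate id f)))
  where
  go : ∀ m (f : Fin m → ℕ) → sumℕ m f ≡ sum (tabulate f)
  go zero    f = refl
  go (suc m) f = cong (f zero +_) (go m (f ∘ suc))

count-mono : ∀ {r n} (p q : Pred r n) → p ⊑ q → count p ≤ count q
count-mono {zero} p q p⊑q = ite (p _) (q _) (p⊑q _)
  where
  ite : ∀ a b → (a ≡ true → b ≡ true) → (if a then 1 else 0) ≤ (if b then 1 else 0)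
  ite false b     _ = z≤n
  ite true  true  _ = ≤-refl
  ite true  false h = contradiction (h refl) λ ()
count-mono {suc r} {n} p q p⊑q =
  sumℕ-mono (n zero) λ x → count-mono (section p x) (section q x) λ g → p⊑q (consT x g)

count-split : ∀ {r n} (q p : Pred r n) → count p ≡ count (q ∩ p) + count (∁ q ∩ p)
count-split {zero} q p = ite (q _) (p _)
  where
  ite : ∀ b a → (if a then 1 else 0) ≡
        (if b ∧ a then 1 else 0) + (if not b ∧ a then 1 else 0)
  ite true  true  = refl
  ite true  false = refl
  ite false a     = refl
count-split {suc r} {n} q p =
  trans (sumℕ-cong (n zero) λ x → count-split (section q x) (section p x))
        (sumℕ-+ (n zero) _ _)

count≤N^r : ∀ {r n} N → (∀ i → n i ≤ N) → (p : Pred r n) → count p ≤ N ^ r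
count≤N^r {zero} N n≤N p = ite (p _)
  where
  ite : ∀ a → (if a then 1 else 0) ≤ 1
  ite true  = ≤-refl
  ite false = z≤n
count≤N^r {suc r} {n} N n≤N p =
  ≤-trans (sumℕ≤* (n zero) (N ^ r) λ x → count≤N^r N (n≤N ∘ suc) (section p x))
          (*-monoˡ-≤ (N ^ r) (n≤N zero))

count-empty : ∀ {r n} (p : Pred r n) → (∀ g → ¬ (p g ≡ true)) → count p ≡ 0
count-empty {zero} p ¬p = ite (p _) (¬p _)
  where
  ite : ∀ a → ¬ (a ≡ true) → (if a then 1 else 0) ≡ 0
  ite false _ = refl
  ite true  h = contradiction refl h
count-empty {suc r} {n} p ¬p =
  n≤0⇒n≡0 (subst (count p ≤_) (*-zeroʳ (n zero))
    (sumℕ≤* (n zero) 0 λ x → ≤-reflexive (count-empty (section p x) λ g → ¬p (consT x g))))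

∑count : ∀ {A : Set} {r n} → (A → Pred r n) → List A → ℕ
∑count F W = sum (map (λ w → count (F w)) W)

∑count-mono : ∀ {A : Set} {r n} (F G : A → Pred r n) W → All (λ w → F w ⊑ G w) W →
              ∑count F W ≤ ∑count G W
∑count-mono F G []      []      = z≤n
∑count-mono F G (w ∷ W) (h ∷ H) = +-mono-≤ (count-mono (F w) (G w) h) (∑count-mono F G W H)

∑count-++ : ∀ {A : Set} {r n} (F : A → Pred r n) W₁ W₂ →
            ∑count F (W₁ ++ W₂) ≡ ∑count F W₁ + ∑count F W₂
∑count-++ F W₁ W₂ = trans (cong sum (map-++ _ W₁ W₂)) (sum-++ (map _ W₁) _)

∑count-split : ∀ {A : Set} {r n} (q : Pred r n) (F : A → Pred r n) W →
               ∑count F W ≡ ∑count (λ w → q ∩ F w) W + ∑count (λ w → ∁ q ∩ F w) W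
∑count-split q F []      = refl
∑count-split q F (w ∷ W) = trans (cong₂ _+_ (count-split q (F w)) (∑count-split q F W))
  (+-interchange (count (q ∩ F w)) _ _ _)

∑count-const : ∀ {A : Set} {r n} (F : A → Pred r n) (q : Pred r n) W → (∀ w → F w ⊑ q) →
               ∑count F W ≤ length W * count q
∑count-const F q []      h = z≤n
∑count-const F q (w ∷ W) h = +-mono-≤ (count-mono (F w) q (h w)) (∑count-const F q W h)

-- Lists sorted along a total preorder

module _ {A : Set} {R : A → A → Set} where

  AllPairs-++⁻ : ∀ xs {ys} → AllPairs R (xs ++ ys) →
                 AllPairs R xs × AllPairs R ys × All (λ x → All (R x) ys) xs
  AllPairs-++⁻ []       ps       = [] , ps , []
  AllPairs-++⁻ (x ∷ xs) (p ∷ ps) with AllPairs-++⁻ xs ps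
  ... | a , b , c = Allₚ.++⁻ˡ xs p ∷ a , b , Allₚ.++⁻ʳ xs p ∷ c

  module _ (R-trans : ∀ {x y z} → R x y → R y z → R x z)
           (R-total : ∀ x y → R x y ⊎ R y x) where

    insert : ∀ x xs → AllPairs R xs → ∃ λ ys → AllPairs R ys × ys ↭ (x ∷ xs)
    insert x []       []       = [ x ] , [] ∷ [] , ↭-refl
    insert x (y ∷ xs) (p ∷ ps) with R-total x y
    ... | inj₁ Rxy = x ∷ y ∷ xs , (Rxy ∷ All.map (R-trans Rxy) p) ∷ p ∷ ps , ↭-refl
    ... | inj₂ Ryx with insert x xs ps
    ...   | ys , s , π = y ∷ ys , All-resp-↭ (↭-sym π) (Ryx ∷ p) ∷ s ,
                         ↭-trans (prep y π) (swap y x ↭-refl)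

    sort : ∀ xs → ∃ λ ys → AllPairs R ys × ys ↭ xs
    sort []       = [] , [] , ↭-refl
    sort (x ∷ xs) with sort xs
    ... | ys , s , π with insert x ys s
    ...   | zs , s′ , π′ = zs , s′ , ↭-trans π′ (prep x π)

split-at : ∀ {A : Set} a b (W : List A) → length W ≤ a + suc b →
           W ≡ [] ⊎ (∃ λ W₁ → ∃ λ w → ∃ λ W₂ →
             W ≡ (W₁ ++ [ w ]) ++ W₂ × length W₁ ≤ a × length W₂ ≤ b)
split-at a       b []      _       = inj₁ refl
split-at zero    b (x ∷ W) (s≤s h) = inj₂ ([] , x , W , refl , z≤n , h)
split-at (suc a) b (x ∷ W) (s≤s h) with split-at a b W h
... | inj₁ refl                                = inj₂ ([] , x , [] , refl , z≤n , z≤n)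
... | inj₂ (W₁ , w , W₂ , refl , h₁ , h₂) = inj₂ (x ∷ W₁ , w , W₂ , refl , s≤s h₁ , h₂)

-- With `b` = 2^d - 1, the list has at most b + 1 + b entries: a pivot and at most `b` on either
-- side. The pivot is bracketed with the left half because the two together form one dyadic block
-- below.
bisect : ∀ {A : Set} d (W : List A) → length W < 2 ^ suc d →
         W ≡ [] ⊎ (∃ λ W₁ → ∃ λ w → ∃ λ W₂ →
           W ≡ (W₁ ++ [ w ]) ++ W₂ × length W₁ < 2 ^ d × length W₂ < 2 ^ d)
bisect d W h with 2 ^ d in eq
... | zero  = contradiction eq (>⇒≢ (m^n>0 2 d))
... | suc b rewrite +-identityʳ b with split-at b b W (s≤s⁻¹ h)
...   | inj₁ e = inj₁ e
...   | inj₂ (W₁ , w , W₂ , e , h₁ , h₂) = inj₂ (W₁ , w , W₂ , e , s≤s h₁ , s≤s h₂)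

-- The sections at the points of the first part are linearly ordered by inclusion, and so on
-- recursively.  Unlike half-spaces with their coordinates, this notion is visibly closed
-- under complements and sections.
Chain : ∀ {r n} → Pred r n → Set
Chain {zero}          p = ⊤
Chain {suc r} {n = n} p =
  (∀ x y → section p x ⊑ section p y ⊎ section p y ⊑ section p x) ×
  (∀ x → Chain (section p x))

Chain-∁ : ∀ {r n} (p : Pred r n) → Chain p → Chain (∁ p)
Chain-∁ {zero}  p c       = tt
Chain-∁ {suc r} p (t , c) =
  (λ x y → [ inj₂ ∘ ∁-antitone (section p x) (section p y)
           , inj₁ ∘ ∁-antitone (section p y) (section p x) ]′ (t x y)) ,
  (λ x → Chain-∁ (section p x) (c x))

Chain-full : ∀ {r n} → Chain {r} {n} full
Chain-full {zero}  = tt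
Chain-full {suc r} = (λ x y → inj₁ λ _ e → e) , λ x → Chain-full

-- Tuples are functions, so without function extensionality this has to be assumed.
Extensional : ∀ {r n} → Pred r n → Set
Extensional {r} {n} p = ∀ (g h : Tuple r n) → (∀ i → g i ≡ h i) → p g ≡ p h

Monotone : ∀ {r n} → Pred r n → Set
Monotone p = Extensional p × Chain p

Monotone-∁ : ∀ {r n} (p : Pred r n) → Monotone p → Monotone (∁ p)
Monotone-∁ p (e , c) = (λ g h g≗h → cong not (e g h g≗h)) , Chain-∁ p c

Monotone-full : ∀ {r n} → Monotone {r} {n} full
Monotone-full = (λ _ _ _ → refl) , Chain-full

consT-cong : ∀ {r} {n : Fin (suc r) → ℕ} (x : Fin (n zero)) {g h : Tuple r (n ∘ suc)} →
             (∀ i → g i ≡ h i) → ∀ i → consT {n = n} x g i ≡ consT {n = n} x h i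
consT-cong x g≗h zero    = refl
consT-cong x g≗h (suc i) = g≗h i

Extensional-section : ∀ {r n} (p : Pred (suc r) n) → Extensional p → ∀ x → Extensional (section p x)
Extensional-section {n = n} p e x g h g≗h = e (consT x g) (consT x h) (consT-cong {n = n} x g≗h)

Monotone-section : ∀ {r n} (p : Pred (suc r) n) → Monotone p → ∀ x → Monotone (section p x)
Monotone-section p (e , c) x = Extensional-section p e x , proj₂ c x

Extensional-⋂ : ∀ {r n} (ps : List (Pred r n)) → All Monotone ps → Extensional (⋂ ps)
Extensional-⋂ []       []             g h g≗h = refl
Extensional-⋂ (p ∷ ps) ((e , _) ∷ ms) g h g≗h = cong₂ _∧_ (e g h g≗h) (Extensional-⋂ ps ms g h g≗h)

-- Eliminating one condition by bisection

-- `block` treats a list on which `l` already implies `p`, at a factor `K` for the conditions other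
-- than `p`. In the bracket, the term with `B` pays for products with at least `k` vertices, the
-- term with `k` for shorter ones. `Good` stands for whatever `block` asks of a list and must
-- survive cutting.
module Bisection {A : Set} {r n} (p F : A → Pred r n) (q : Pred r n) (K B k : ℕ)
  (Good : List A → Set)
  (good-++ : ∀ {V} W → Good (W ++ V) → Good W × Good V)
  (mono  : ∀ x → Monotone (p x))
  (F⊑q   : ∀ x → F x ⊑ q)
  (block : ∀ W l h → Monotone l → Monotone h → Good W →
           (∀ {w} → w ∈ W → l ⊑ p w) →
           ∑count (λ w → l ∩ h ∩ F w) W ≤ K * (length W * B + k * count (l ∩ h ∩ q)))
  where

  cell : Pred r n → Pred r n → A → Pred r n
  cell l h w = p w ∩ l ∩ h ∩ F w

  -- W is sorted with the easiest points first, so the x with p x g form an initial segment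
  -- of W; l ∩ h holds at least where this segment ends within W.  Replacing l or h when
  -- descending, instead of adding a condition, is what keeps their number independent of d.
  bisection : ∀ d W l h → Monotone l → Monotone h → Good W → AllPairs (λ x y → p y ⊑ p x) W →
              length W < 2 ^ d →
              (∀ {w} → w ∈ W → p w ⊑ l) → (∀ {w} → w ∈ W → ∁ (p w) ⊑ h) →
              ∑count (cell l h) W ≤ d * (K * (length W * B + k * count (l ∩ h ∩ q)))
  bisection zero    []      l h cl ch u s _ p⊑l ∁p⊑h = z≤n
  bisection zero    (_ ∷ _) l h cl ch u s (s≤s ()) p⊑l ∁p⊑h
  bisection (suc d) W l h cl ch u s |W|<2^d p⊑l ∁p⊑h with bisect d W |W|<2^d
  ... | inj₁ refl = z≤n
  -- The pairs of a vertex x and a tuple g fall into three classes. If x is in `U` and `p w g`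
  -- holds, sorting gives `p x g` for free, so `block` applies. If x is in `U` and `p w g` fails,
  -- recursion on `W₁` applies with `∁ (p w)` as the new `h`. If x is in `W₂`, then `p x` implies
  -- `p w`, which becomes the new `l`.
  ... | inj₂ (W₁ , w , W₂ , refl , |W₁|< , |W₂|<) = begin
    ∑count (cell l h) (U ++ W₂)
      ≡⟨ ∑count-++ (cell l h) U W₂ ⟩
    ∑count (cell l h) U + ∑count (cell l h) W₂
      ≡⟨ cong (_+ ∑count (cell l h) W₂) (∑count-split (p w) (cell l h) U) ⟩
    ∑count (λ x → p w ∩ cell l h x) U + ∑count (λ x → ∁ (p w) ∩ cell l h x) U + ∑count (cell l h) W₂
      ≤⟨ +-mono-≤ (+-mono-≤ on-block below) above ⟩
    K * (length U * B + k * c₂) + d * (K * (length W₁ * B + k * c₁)) + d * (K * (length W₂ * B + k * c₂))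
      ≤⟨ arith ⟩
    suc d * (K * (length (U ++ W₂) * B + k * count (l ∩ h ∩ q))) ∎
    where
    open ≤-Reasoning
    U = W₁ ++ [ w ]
    c₁ = count (l ∩ ∁ (p w) ∩ q)
    c₂ = count (p w ∩ h ∩ q)

    u₁ = good-++ U u
    s₁ = AllPairs-++⁻ U s
    s₂ = AllPairs-++⁻ W₁ (proj₁ s₁)

    w∈U : w ∈ U
    w∈U = ∈-++⁺ʳ W₁ (here refl)

    p-w⊑ : ∀ {x} → x ∈ U → p w ⊑ p x
    p-w⊑ x∈U g e with ∈-++⁻ W₁ x∈U
    ... | inj₁ x∈W₁        = All.head (All.lookup (proj₂ (proj₂ s₂)) x∈W₁) g e
    ... | inj₂ (here refl) = e

    ⊑p-w : ∀ {x} → x ∈ W₂ → p x ⊑ p w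
    ⊑p-w x∈W₂ = All.lookup (All.lookup (proj₂ (proj₂ s₁)) w∈U) x∈W₂

    |W|≡ : length (U ++ W₂) ≡ length U + length W₂
    |W|≡ = length-++ U

    |U|≡ : length U ≡ length W₁ + 1
    |U|≡ = length-++ W₁

    |U|≤ : length U ≤ length (U ++ W₂)
    |U|≤ = ≤-trans (m≤m+n _ _) (≤-reflexive (sym |W|≡))

    on-block : ∑count (λ x → p w ∩ cell l h x) U ≤ K * (length U * B + k * c₂)
    on-block = ≤-trans
      (∑count-mono _ (λ x → p w ∩ h ∩ F x) U (All.universal (λ x g e →
        let e₁ , e₂ = ∩-elim (p w) (cell l h x) g e
            _  , e₃ = ∩-elim (p x) (l ∩ h ∩ F x) g e₂
            _  , e₄ = ∩-elim l (h ∩ F x) g e₃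
        in ∩-intro (p w) (h ∩ F x) g e₁ e₄) U))
      (block U (p w) h (mono w) ch (proj₁ u₁) p-w⊑)

    below : ∑count (λ x → ∁ (p w) ∩ cell l h x) U ≤ d * (K * (length W₁ * B + k * c₁))
    below = begin
      ∑count G U ≡⟨ ∑count-++ G W₁ [ w ] ⟩
      -- The pivot contributes nothing, since `G w` demands both `p w` and its negation.
      ∑count G W₁ + (count (G w) + 0)
        ≡⟨ cong (λ m → ∑count G W₁ + (m + 0)) (count-empty (G w) λ g e →
             let e₁ , e₂ = ∩-elim (∁ (p w)) (cell l h w) g e
             in ∁-contra (p w) g e₁ (proj₁ (∩-elim (p w) (l ∩ h ∩ F w) g e₂))) ⟩
      ∑count G W₁ + 0 ≡⟨ +-identityʳ _ ⟩
      ∑count G W₁ ≤⟨ ∑count-mono G (cell l (∁ (p w))) W₁ (All.universal (λ x g e →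
        let e₁ , e₂ = ∩-elim (∁ (p w)) (cell l h x) g e
            e₃ , e₄ = ∩-elim (p x) (l ∩ h ∩ F x) g e₂
            e₅ , e₆ = ∩-elim l (h ∩ F x) g e₄
            _  , e₇ = ∩-elim h (F x) g e₆
        in ∩-intro (p x) (l ∩ ∁ (p w) ∩ F x) g e₃
             (∩-intro l (∁ (p w) ∩ F x) g e₅ (∩-intro (∁ (p w)) (F x) g e₁ e₇))) W₁) ⟩
      ∑count (cell l (∁ (p w))) W₁
        ≤⟨ bisection d W₁ l (∁ (p w)) cl (Monotone-∁ (p w) (mono w))
             (proj₁ (good-++ W₁ (proj₁ u₁))) (proj₁ s₂) |W₁|<
             (λ x∈ → p⊑l (∈-++⁺ˡ (∈-++⁺ˡ x∈)))
             (λ {x} x∈ → ∁-antitone (p w) (p x) (p-w⊑ (∈-++⁺ˡ x∈))) ⟩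
      d * (K * (length W₁ * B + k * c₁)) ∎
      where
      G : A → Pred r n
      G x = ∁ (p w) ∩ cell l h x

    above : ∑count (cell l h) W₂ ≤ d * (K * (length W₂ * B + k * c₂))
    above = ≤-trans
      (∑count-mono (cell l h) (cell (p w) h) W₂ (All.tabulate λ {x} x∈ g e →
        let e₁ , e₂ = ∩-elim (p x) (l ∩ h ∩ F x) g e
            _  , e₃ = ∩-elim l (h ∩ F x) g e₂
        in ∩-intro (p x) (p w ∩ h ∩ F x) g e₁ (∩-intro (p w) (h ∩ F x) g (⊑p-w x∈ g e₁) e₃)))
      (bisection d W₂ (p w) h (mono w) ch (proj₂ u₁) (proj₁ (proj₂ s₁)) |W₂|<
        ⊑p-w (λ x∈ → ∁p⊑h (∈-++⁺ʳ U x∈)))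

    -- The two regions are separated by `p w`, and the invariants `p w ⊑ l` and `∁ (p w) ⊑ h` place
    -- both inside `l ∩ h ∩ q`. Hence the terms with `k` do not double from one level to the next.
    c₁+c₂≤ : c₁ + c₂ ≤ count (l ∩ h ∩ q)
    c₁+c₂≤ = begin
      c₁ + c₂ ≤⟨ +-mono-≤
        (count-mono _ (∁ (p w) ∩ (l ∩ h ∩ q)) λ g e →
          let e₁ , e₂ = ∩-elim l (∁ (p w) ∩ q) g e
              e₃ , e₄ = ∩-elim (∁ (p w)) q g e₂
          in ∩-intro (∁ (p w)) (l ∩ h ∩ q) g e₃ (∩-intro l (h ∩ q) g e₁
               (∩-intro h q g (∁p⊑h (∈-++⁺ˡ w∈U) g e₃) e₄)))
        (count-mono _ (p w ∩ (l ∩ h ∩ q)) λ g e →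
          let e₁ , e₂ = ∩-elim (p w) (h ∩ q) g e
          in ∩-intro (p w) (l ∩ h ∩ q) g e₁ (∩-intro l (h ∩ q) g (p⊑l (∈-++⁺ˡ w∈U) g e₁) e₂)) ⟩
      count (∁ (p w) ∩ (l ∩ h ∩ q)) + count (p w ∩ (l ∩ h ∩ q)) ≡⟨ +-comm (count (∁ (p w) ∩ (l ∩ h ∩ q))) _ ⟩
      count (p w ∩ (l ∩ h ∩ q)) + count (∁ (p w) ∩ (l ∩ h ∩ q)) ≡⟨ count-split (p w) (l ∩ h ∩ q) ⟨
      count (l ∩ h ∩ q) ∎

    arith : K * (length U * B + k * c₂) + d * (K * (length W₁ * B + k * c₁)) + d * (K * (length W₂ * B + k * c₂))
            ≤ suc d * (K * (length (U ++ W₂) * B + k * count (l ∩ h ∩ q)))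
    arith = begin
      K * (length U * B + k * c₂) + d * (K * (length W₁ * B + k * c₁)) + d * (K * (length W₂ * B + k * c₂))
        ≡⟨ solve 9 (λ K B k d u w₁ w₂ c₁ c₂ →
             K :* (u :* B :+ k :* c₂) :+ d :* (K :* (w₁ :* B :+ k :* c₁)) :+ d :* (K :* (w₂ :* B :+ k :* c₂))
             := K :* (u :* B :+ k :* c₂) :+ d :* (K :* ((w₁ :+ w₂) :* B :+ k :* (c₁ :+ c₂)))) refl
             K B k d (length U) (length W₁) (length W₂) c₁ c₂ ⟩
      K * (length U * B + k * c₂) + d * (K * ((length W₁ + length W₂) * B + k * (c₁ + c₂)))
        -- One copy of the final bracket pays for the block, `d` copies for both recursive calls
        -- together.
        ≤⟨ +-mono-≤
             (*-monoʳ-≤ K (+-mono-≤ (*-monoˡ-≤ B |U|≤)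
               (*-monoʳ-≤ k (≤-trans (m≤n+m c₂ c₁) c₁+c₂≤))))
             (*-monoʳ-≤ d (*-monoʳ-≤ K (+-mono-≤
               (*-monoˡ-≤ B (≤-trans
                 (+-monoˡ-≤ (length W₂) (≤-trans (m≤m+n (length W₁) 1) (≤-reflexive (sym |U|≡))))
                 (≤-reflexive (sym |W|≡))))
               (*-monoʳ-≤ k c₁+c₂≤)))) ⟩
      suc d * (K * (length (U ++ W₂) * B + k * count (l ∩ h ∩ q))) ∎
      where open +-*-Solver

-- Predicates containing no large box

BoxFree : ∀ {r n} → ℕ → Pred r n → Set
BoxFree {r} {n} k p = KFree k (record { size = n ; edge = p })

BoxFree-⊑ : ∀ {r n k} (p q : Pred r n) → p ⊑ q → BoxFree k q → BoxFree k p
BoxFree-⊑ p q p⊑q free (c , inj , box) = free (c , inj , λ j → p⊑q _ (box j))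

lookup-injective : ∀ {A : Set} {xs : List A} → Unique xs → ∀ i j → lookup xs i ≡ lookup xs j → i ≡ j
lookup-injective (_ ∷ _)  zero    zero    _ = refl
lookup-injective (p ∷ _)  zero    (suc j) e = contradiction e (All.lookup p (∈-lookup j))
lookup-injective (p ∷ _)  (suc i) zero    e = contradiction (sym e) (All.lookup p (∈-lookup i))
lookup-injective (_ ∷ us) (suc i) (suc j) e = cong suc (lookup-injective us i j e)

-- A box in `q` times `k` distinct entries of `W` would be a box in `f`. Extensionality enters
-- because the resulting tuples have the form `consT` only pointwise.
BoxFree-fibre : ∀ {r n k} (f : Pred (suc r) n) (q : Pred r (n ∘ suc)) W → Extensional f →
                BoxFree k f → Unique W → k ≤ length W →
                (∀ {w} → w ∈ W → q ⊑ section f w) → BoxFree k q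
BoxFree-fibre {r} {n} {k} f q W ext free u k≤ q⊑ (c , inj , box) = free (c′ , inj′ , box′)
  where
  c′ : (i : Fin (suc r)) → Fin k → Fin (n i)
  c′ zero    a = lookup W (inject≤ a k≤)
  c′ (suc i) a = c i a

  inj′ : ∀ i a b → c′ i a ≡ c′ i b → a ≡ b
  inj′ zero    a b e = inject≤-injective k≤ k≤ a b (lookup-injective u _ _ e)
  inj′ (suc i) a b e = inj i a b e

  box′ : ∀ (j : Fin (suc r) → Fin k) → f (λ i → c′ i (j i)) ≡ true
  box′ j = trans (ext _ (consT (c′ zero (j zero)) (λ i → c i (j (suc i)))) λ { zero → refl ; (suc i) → refl })
                 (q⊑ (∈-lookup (inject≤ (j zero) k≤)) _ (box (j ∘ suc)))

-- All empty tuples agree pointwise only, so one of them is fixed.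
nil : ∀ {n} → Tuple 0 n
nil ()

count-unary : ∀ {n k} (f : Pred 1 n) → Extensional f → BoxFree k f → count f ≤ k
count-unary {n} {k} f ext free =
  ≤-trans (≤-reflexive (sumℕ≡sum (n zero) (λ x → count (section f x))))
    (≤-trans (filtered (allFin (n zero))) (<⇒≤ (≰⇒> few)))
  where
  f? : ∀ x → Dec (f (consT x nil) ≡ true)
  f? x = f (consT x nil) Bool.≟ true

  filtered : ∀ W → ∑count (section f) W ≤ length (filter f? W)
  filtered []      = z≤n
  filtered (w ∷ W) with f? w
  ... | yes _ =
    +-mono-≤ (count≤N^r 0 (λ ()) (section f w)) (filtered W)
  ... | no ¬e rewrite count-empty (section f w) (λ g e → ¬e (trans (ext _ _ (consT-cong {n = n} w λ ())) e)) = filtered W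

  few : ¬ (k ≤ length (filter f? (allFin (n zero))))
  few k≤ = BoxFree-fibre f full (filter f? (allFin (n zero))) ext free (Uniqueₚ.filter⁺ f? (Uniqueₚ.allFin⁺ (n zero))) k≤
    (λ {w} w∈ g _ → trans (ext _ _ (consT-cong {n = n} w λ ())) (proj₂ (∈-filter⁻ f? {xs = allFin (n zero)} w∈)))
    -- With no parts left, `full` contains the empty box, so it cannot be `BoxFree`.
    ((λ ()) , (λ ()) , λ _ → refl)

-- Eliminating the first vertex part

-- `bound` is the induction hypothesis on the number of parts; `M` is the number of conditions on
-- the remaining parts once none involves the first part.
module Elimination {r n} (f : Pred (suc r) n) (ext : Extensional f) (k L M B : ℕ)
  (free  : BoxFree k f)
  (bound : ∀ qs → All Monotone qs → length qs ≡ M → BoxFree k (⋂ qs) →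
           count {r} {n ∘ suc} (⋂ qs) ≤ B)
  where

  -- Induction on `ps`. Each condition involving the first vertex is traded for two that do not,
  -- which keeps `length qs + 2 * length ps` fixed, and costs a factor `L`, the depth of the
  -- bisection.
  elimination : ∀ (ps : List (Pred (suc r) n)) (qs : List (Pred r (n ∘ suc))) W →
                All Monotone ps → All Monotone qs → length qs + 2 * length ps ≡ M →
                Unique W → length W < 2 ^ L →
                (∀ {w} → w ∈ W → section (⋂ ps) w ∩ ⋂ qs ⊑ section f w) →
                ∑count (λ w → section (⋂ ps) w ∩ ⋂ qs) W
                  ≤ L ^ length ps * (length W * B + k * count (⋂ qs))
  elimination [] qs W [] mqs |qs| u |W| ⊑f = begin
    ∑count (λ w → ⋂ qs) W ≤⟨ ∑count-const (λ _ → ⋂ qs) (⋂ qs) W (λ _ _ e → e) ⟩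
    length W * count (⋂ qs) ≤⟨ bounded ⟩
    length W * B + k * count (⋂ qs) ≡⟨ +-identityʳ _ ⟨
    1 * (length W * B + k * count (⋂ qs)) ∎
    where
    open ≤-Reasoning
    bounded : length W * count (⋂ qs) ≤ length W * B + k * count (⋂ qs)
    -- What remains is the product of `W` and `⋂ qs`. If `W` is long, `⋂ qs` is box-free and `bound`
    -- applies to it; if `W` is short, its length is at most `k`.
    bounded with k ≤? length W
    ... | yes k≤ = ≤-trans
            (*-monoʳ-≤ (length W) (bound qs mqs (trans (sym (+-identityʳ _)) |qs|)
              (BoxFree-fibre f (⋂ qs) W ext free u k≤ ⊑f)))
            (m≤m+n _ _)
    ... | no k≰ = ≤-trans (*-monoˡ-≤ (count (⋂ qs)) (<⇒≤ (≰⇒> k≰))) (m≤n+m _ _)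
  elimination (p ∷ ps) qs W (mp ∷ mps) mqs |qs| u |W| ⊑f
    with sort {R = λ x y → section p y ⊑ section p x}
           (λ y⊑x z⊑y g e → y⊑x g (z⊑y g e))
           (λ x y → proj₁ (proj₂ mp) y x) W
  ... | W′ , sorted , π = begin
    ∑count (λ w → section (⋂ (p ∷ ps)) w ∩ ⋂ qs) W
      ≡⟨ sum-↭ (map⁺ _ (↭-sym π)) ⟩
    ∑count (λ w → section (⋂ (p ∷ ps)) w ∩ ⋂ qs) W′
      ≤⟨ ∑count-mono _ (cell full full) W′ (All.universal (λ w g e →
           let e₁ , e₂ = ∩-elim (section (⋂ (p ∷ ps)) w) (⋂ qs) g e
               e₃ , e₄ = ∩-elim (section p w) (section (⋂ ps) w) g e₁
           in ∩-intro (section p w) (F w) g e₃ (∩-intro (section (⋂ ps) w) (⋂ qs) g e₄ e₂)) W′) ⟩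
    ∑count (cell full full) W′
      -- Starting from `full` makes both invariants trivial. A block whose `h` is still `full`
      -- counts it as a condition, so the number of conditions is exactly `M` everywhere.
      ≤⟨ bisection L W′ full full Monotone-full Monotone-full
           (Permₛ.Unique-resp-↭ (setoid _) (↭⇒↭ₛ (↭-sym π)) u , |W′| , λ w∈ → ∈-resp-↭ π w∈)
           sorted |W′|
           (λ _ _ _ → refl) (λ _ _ _ → refl) ⟩
    L * (L ^ length ps * (length W′ * B + k * count (⋂ qs)))
      ≡⟨ *-assoc L (L ^ length ps) _ ⟨
    L ^ length (p ∷ ps) * (length W′ * B + k * count (⋂ qs))
      ≡⟨ cong (λ m → L ^ length (p ∷ ps) * (m * B + k * count (⋂ qs))) (↭-length π) ⟩
    L ^ length (p ∷ ps) * (length W * B + k * count (⋂ qs)) ∎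
    where
    open ≤-Reasoning

    F : Fin (n zero) → Pred r (n ∘ suc)
    F w = section (⋂ ps) w ∩ ⋂ qs

    |W′| : length W′ < 2 ^ L
    |W′| = ≤-<-trans (≤-reflexive (↭-length π)) |W|

    -- These are the demands of the recursive call of `elimination` on a block; the membership
    -- clause lets it inherit `⊑f`.
    Good : List (Fin (n zero)) → Set
    Good V = Unique V × length V < 2 ^ L × (∀ {w} → w ∈ V → w ∈ W)

    good-++ : ∀ {V} U → Good (U ++ V) → Good U × Good V
    good-++ {V} U (uUV , |UV| , UV⊆W) with AllPairs-++⁻ U uUV
    ... | uU , uV , _ =
      (uU , ≤-<-trans (≤-trans (m≤m+n _ _) (≤-reflexive (sym (length-++ U)))) |UV| , UV⊆W ∘ ∈-++⁺ˡ) ,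
      (uV , ≤-<-trans (≤-trans (m≤n+m _ (length U)) (≤-reflexive (sym (length-++ U)))) |UV| ,
       UV⊆W ∘ ∈-++⁺ʳ U)

    block : ∀ V l h → Monotone l → Monotone h → Good V →
            (∀ {w} → w ∈ V → l ⊑ section p w) →
            ∑count (λ w → l ∩ h ∩ F w) V
              ≤ L ^ length ps * (length V * B + k * count (l ∩ h ∩ ⋂ qs))
    block V l h ml mh (uV , |V| , V⊆W) l⊑ = ≤-trans
      (∑count-mono _ (λ w → section (⋂ ps) w ∩ ⋂ (l ∷ h ∷ qs)) V (All.universal (λ w g e →
        let e₁ , e₂ = ∩-elim l (h ∩ F w) g e
            e₃ , e₄ = ∩-elim h (F w) g e₂
            e₅ , e₆ = ∩-elim (section (⋂ ps) w) (⋂ qs) g e₄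
        in ∩-intro (section (⋂ ps) w) (⋂ (l ∷ h ∷ qs)) g e₅
             (∩-intro l (h ∩ ⋂ qs) g e₁ (∩-intro h (⋂ qs) g e₃ e₆))) V))
      (elimination ps (l ∷ h ∷ qs) V mps (ml ∷ mh ∷ mqs) (trans count-conditions |qs|) uV |V| λ {w} w∈ g e →
        let e₁ , e₂ = ∩-elim (section (⋂ ps) w) (⋂ (l ∷ h ∷ qs)) g e
            e₃ , e₄ = ∩-elim l (h ∩ ⋂ qs) g e₂
            _  , e₅ = ∩-elim h (⋂ qs) g e₄
        in ⊑f (V⊆W w∈) g (∩-intro (section (⋂ (p ∷ ps)) w) (⋂ qs) g
             (∩-intro (section p w) (section (⋂ ps) w) g (l⊑ w∈ g e₃) e₁) e₅))
      where
      count-conditions : 2 + length qs + 2 * length ps ≡ length qs + 2 * suc (length ps)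
      count-conditions = solve 2 (λ a b → con 2 :+ a :+ con 2 :* b := a :+ con 2 :* (con 1 :+ b)) refl
        (length qs) (length ps)
        where open +-*-Solver

    open Bisection (section p) F (⋂ qs) (L ^ length ps) B k Good good-++
      (Monotone-section p mp)
      (λ w g e → proj₂ (∩-elim (section (⋂ ps) w) (⋂ qs) g e))
      block

-- Induction on the number of parts

exponent-step : ∀ s r → s * (2 ^ suc r ∸ 1) ≡ s + 2 * s * (2 ^ r ∸ 1)
exponent-step s r with 2 ^ r in eq
... | zero  = contradiction eq (>⇒≢ (m^n>0 2 r))
-- With 2^r = e + 1 the truncated subtractions disappear and both sides equal s(2e + 1).
... | suc e = solve 2 (λ s e → s :* (e :+ (con 1 :+ (e :+ con 0))) := s :+ con 2 :* s :* e) refl s e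
  where open +-*-Solver

-- The index `r` stands for r + 1 parts, so that it is also the exponent of `N`. Since `N` and `L`
-- bound all parts at once, they serve unchanged for the remaining parts. The constant starts at `k`
-- and grows by `k` with each part, independently of `s`.
count-boxFree : ∀ r s k → ∃ λ C → ∀ {n : Fin (suc r) → ℕ} N L → 1 ≤ L →
  (∀ i → n i ≤ N) → (∀ i → n i < 2 ^ L) →
  (ps : List (Pred (suc r) n)) → All Monotone ps → length ps ≡ s → BoxFree k (⋂ ps) →
  count (⋂ ps) ≤ C * N ^ r * L ^ (s * (2 ^ r ∸ 1))
count-boxFree zero s k = k , λ N L 1≤L n≤N n<2^L ps mps |ps| free → begin
  count (⋂ ps)                  ≤⟨ count-unary (⋂ ps) (Extensional-⋂ ps mps) free ⟩
  k                             ≡⟨ trans (*-identityʳ _) (*-identityʳ k) ⟨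
  k * 1 * 1                     ≡⟨ cong (λ e → k * 1 * L ^ e) (*-zeroʳ s) ⟨
  k * 1 * L ^ (s * (2 ^ 0 ∸ 1)) ∎
  where open ≤-Reasoning
count-boxFree (suc r) s k with count-boxFree r (2 * s) k
... | C , IH = C + k , λ {n} N L 1≤L n≤N n<2^L ps mps |ps| free →
  let
    E = L ^ (2 * s * (2 ^ r ∸ 1))
    B = C * N ^ r * E
    open Elimination (⋂ ps) (Extensional-⋂ ps mps) k L (2 * s) B free
      (λ qs mqs |qs| → IH N L 1≤L (n≤N ∘ suc) (n<2^L ∘ suc) qs mqs |qs|)
    W = allFin (n zero)
    |W|≡ = length-tabulate {n = n zero} id
    1≤E : 1 ≤ E
    1≤E = m^n>0 L {{>-nonZero 1≤L}} (2 * s * (2 ^ r ∸ 1))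
    open ≤-Reasoning
  in begin
    count (⋂ ps)
      ≡⟨ sumℕ≡sum (n zero) _ ⟩
    ∑count (section (⋂ ps)) W
      ≤⟨ ∑count-mono _ (λ w → section (⋂ ps) w ∩ ⋂ []) W
           (All.universal (λ w g e → ∩-intro (section (⋂ ps) w) (⋂ []) g e refl) W) ⟩
    ∑count (λ w → section (⋂ ps) w ∩ ⋂ []) W
      ≤⟨ elimination ps [] W mps [] (cong (2 *_) |ps|) (Uniqueₚ.allFin⁺ (n zero))
           (≤-<-trans (≤-reflexive |W|≡) (n<2^L zero))
           (λ {w} _ g e → proj₁ (∩-elim (section (⋂ ps) w) (⋂ []) g e)) ⟩
    L ^ length ps * (length W * B + k * count {suc r} {n ∘ suc} (⋂ []))
      ≤⟨ *-mono-≤ (≤-reflexive (cong (L ^_) |ps|)) (+-mono-≤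
           (*-monoˡ-≤ B (≤-trans (≤-reflexive |W|≡) (n≤N zero)))
           (*-monoʳ-≤ k (count≤N^r N (n≤N ∘ suc) (⋂ [])))) ⟩
    L ^ s * (N * B + k * N ^ suc r)
      -- The term from the short products has no factor `E`; as `1 ≤ E`, it may be given one, and
      -- the two terms then combine.
      ≤⟨ *-monoʳ-≤ (L ^ s) (+-monoʳ-≤ (N * B) (*-monoʳ-≤ k
           (≤-trans (≤-reflexive (sym (*-identityʳ _))) (*-monoʳ-≤ (N ^ suc r) 1≤E)))) ⟩
    L ^ s * (N * B + k * (N ^ suc r * E))
      ≡⟨ collect (L ^ s) N C (N ^ r) E k ⟩
    (C + k) * N ^ suc r * (L ^ s * E)
      ≡⟨ cong ((C + k) * N ^ suc r *_) (trans (cong (L ^_) (exponent-step s r)) (^-distribˡ-+-* L s _)) ⟨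
    (C + k) * N ^ suc r * L ^ (s * (2 ^ suc r ∸ 1)) ∎
  where
  collect : ∀ l N C n E k → l * (N * (C * n * E) + k * (N * n * E)) ≡ (C + k) * (N * n) * (l * E)
  collect = solve 6 (λ l N C n E k → l :* (N :* (C :* n :* E) :+ k :* (N :* n :* E))
                       := (C :+ k) :* (N :* n) :* (l :* E)) refl
    where open +-*-Solver

-- Union bound and finite intersections

count-cover : ∀ {r n} m (q : Fin m → Pred r n) (p : Pred r n) b →
              (∀ g → p g ≡ true → ∃ λ j → q j g ≡ true) → (∀ j → count (q j) ≤ b) →
              count p ≤ m * b
count-cover zero    q p b cover q≤b =
  ≤-reflexive (count-empty p λ g e → ¬Fin0 (proj₁ (cover g e)))
count-cover (suc m) q p b cover q≤b = begin
  count p                                         ≡⟨ count-split (q zero) p ⟩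
  count (q zero ∩ p) + count (∁ (q zero) ∩ p)
    ≤⟨ +-mono-≤ (≤-trans (count-mono _ (q zero) λ g e → proj₁ (∩-elim (q zero) p g e)) (q≤b zero))
                (count-cover m (q ∘ suc) _ b rest (q≤b ∘ suc)) ⟩
  b + m * b                                       ∎
  where
  open ≤-Reasoning
  rest : ∀ g → (∁ (q zero) ∩ p) g ≡ true → ∃ λ j → q (suc j) g ≡ true
  rest g e with ∩-elim (∁ (q zero)) p g e
  ... | e₁ , e₂ with cover g e₂
  ...   | zero  , f = contradiction f (∁-contra (q zero) g e₁)
  ...   | suc j , f = j , f

⋂-tabulate⁻ : ∀ {X : Set} m (p : Fin m → X → Bool) g → ⋂ (tabulate p) g ≡ true → ∀ j → p j g ≡ true
⋂-tabulate⁻ (suc m) p g e zero    = proj₁ (∩-elim (p zero) (⋂ (tabulate (p ∘ suc))) g e)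
⋂-tabulate⁻ (suc m) p g e (suc j) =
  ⋂-tabulate⁻ m (p ∘ suc) g (proj₂ (∩-elim (p zero) (⋂ (tabulate (p ∘ suc))) g e)) j

⋂-tabulate⁺ : ∀ {X : Set} m (p : Fin m → X → Bool) g → (∀ j → p j g ≡ true) → ⋂ (tabulate p) g ≡ true
⋂-tabulate⁺ zero    p g h = refl
⋂-tabulate⁺ (suc m) p g h =
  ∩-intro (p zero) (⋂ (tabulate (p ∘ suc))) g (h zero) (⋂-tabulate⁺ m (p ∘ suc) g (h ∘ suc))

-- Half-spaces are chain predicates

module HalfSpaces (ℝ : RealField) where
  private module R = RealField ℝ
  open RealField ℝ using (Carrier; _≈_; 0#) renaming (_+_ to _⊕_; _<_ to _<ᴿ_; _≤_ to _≤ᴿ_)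
  open IsStrictTotalOrder R.isStrictTotalOrder
    using (compare; <-respˡ-≈; <-respʳ-≈) renaming (trans to <ᴿ-trans)
  open Semilinear ℝ

  <-≤-transᴿ : ∀ {x y z} → x <ᴿ y → y ≤ᴿ z → x <ᴿ z
  <-≤-transᴿ x<y (inj₁ y<z) = <ᴿ-trans x<y y<z
  <-≤-transᴿ x<y (inj₂ y≈z) = <-respʳ-≈ y≈z x<y

  ≤-<-transᴿ : ∀ {x y z} → x ≤ᴿ y → y <ᴿ z → x <ᴿ z
  ≤-<-transᴿ (inj₁ x<y) y<z = <ᴿ-trans x<y y<z
  ≤-<-transᴿ (inj₂ x≈y) y<z = <-respˡ-≈ (R.sym x≈y) y<z

  ≤-transᴿ : ∀ {x y z} → x ≤ᴿ y → y ≤ᴿ z → x ≤ᴿ z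
  ≤-transᴿ (inj₁ x<y) y≤z        = inj₁ (<-≤-transᴿ x<y y≤z)
  ≤-transᴿ (inj₂ x≈y) (inj₁ y<z) = inj₁ (≤-<-transᴿ (inj₂ x≈y) y<z)
  ≤-transᴿ (inj₂ x≈y) (inj₂ y≈z) = inj₂ (R.trans x≈y y≈z)

  ≤-totalᴿ : ∀ x y → x ≤ᴿ y ⊎ y ≤ᴿ x
  ≤-totalᴿ x y with compare x y
  ... | tri< x<y _ _ = inj₁ (inj₁ x<y)
  ... | tri≈ _ x≈y _ = inj₁ (inj₂ x≈y)
  ... | tri> _ _ y<x = inj₂ (inj₁ y<x)

  +-monoˡ-≤ᴿ : ∀ {x y} z → x ≤ᴿ y → x ⊕ z ≤ᴿ y ⊕ z
  +-monoˡ-≤ᴿ z (inj₁ x<y) = inj₁ (R.+-mono-< z x<y)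
  +-monoˡ-≤ᴿ z (inj₂ x≈y) = inj₂ (R.+-congʳ x≈y)

  -- A Boolean for strictness lets the closed and the open half-spaces share one argument.
  Nonpos : Bool → Carrier → Set
  Nonpos strict x = if strict then x <ᴿ 0# else x ≤ᴿ 0#

  nonpos? : ∀ strict x → Dec (Nonpos strict x)
  nonpos? true  x = IsStrictTotalOrder._<?_ R.isStrictTotalOrder x 0#
  nonpos? false x = IsStrictTotalOrder._<?_ R.isStrictTotalOrder x 0# ⊎-dec
                    IsStrictTotalOrder._≟_ R.isStrictTotalOrder x 0#

  Nonpos-≤ : ∀ strict {x y} → x ≤ᴿ y → Nonpos strict y → Nonpos strict x
  Nonpos-≤ true  = ≤-<-transᴿ
  Nonpos-≤ false = ≤-transᴿ

  -- Here `P` will be `p ≤ toℕ j`: deciding it merges the two implications in `inBasic` into a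
  -- single inequality of known strictness.
  Nonpos-does⁺ : ∀ {P : Set} {x} (P? : Dec P) → (¬ P → x ≤ᴿ 0#) → (P → x <ᴿ 0#) → Nonpos (does P?) x
  Nonpos-does⁺ (yes p) ≤0 <0 = <0 p
  Nonpos-does⁺ (no ¬p) ≤0 <0 = ≤0 ¬p

  Nonpos-does⁻ : ∀ {P : Set} {x} (P? : Dec P) → Nonpos (does P?) x → (¬ P → x ≤ᴿ 0#) × (P → x <ᴿ 0#)
  Nonpos-does⁻ (yes p) h = (λ ¬p → contradiction p ¬p) , λ _ → h
  Nonpos-does⁻ (no ¬p) h = (λ _ → h) , λ p → contradiction p ¬p

  -- Fixing the first vertex x only adds `u zero x` to the constant, and a smaller value gives a
  -- weaker condition, so the sections are ordered by these numbers. Two implications describe `p`,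
  -- since the sum for a section has the required form only up to `≈`.
  Chain-halfSpace : ∀ {r n} strict (u : (i : Fin r) → Fin (n i) → Carrier) c (p : Pred r n) →
    (∀ g → p g ≡ true → Nonpos strict (sumR r (λ i → u i (g i)) ⊕ c)) →
    (∀ g → Nonpos strict (sumR r (λ i → u i (g i)) ⊕ c) → p g ≡ true) →
    Chain p
  Chain-halfSpace {zero}          strict u c p p⇒ p⇐ = tt
  Chain-halfSpace {suc r} {n = n} strict u c p p⇒ p⇐ = comparable , λ x →
    Chain-halfSpace strict (u ∘ suc) (u zero x ⊕ c) (section p x)
      (λ g e → Nonpos-≤ strict (inj₂ (R.sym (shift (u zero x) _ c))) (p⇒ (consT x g) e))
      (λ g h → p⇐ (consT x g) (Nonpos-≤ strict (inj₂ (shift (u zero x) _ c)) h))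
    where
    shift : ∀ a b c → (a ⊕ b) ⊕ c ≈ b ⊕ (a ⊕ c)
    shift a b c = R.trans (R.+-congʳ (R.+-comm a b)) (R.+-assoc b a c)

    ordered : ∀ x y → u zero x ≤ᴿ u zero y → section p y ⊑ section p x
    ordered x y ux≤uy g e = p⇐ (consT x g)
      (Nonpos-≤ strict (+-monoˡ-≤ᴿ c (+-monoˡ-≤ᴿ _ ux≤uy)) (p⇒ (consT y g) e))

    comparable : ∀ x y → section p x ⊑ section p y ⊎ section p y ⊑ section p x
    comparable x y = [ inj₂ ∘ ordered x y , inj₁ ∘ ordered y x ]′ (≤-totalᴿ (u zero x) (u zero y))

  -- Propositional equality is used so that it can be carried through the decision `nonpos?`.
  sumR-cong : ∀ m {f g : Fin m → Carrier} → (∀ i → f i ≡ g i) → sumR m f ≡ sumR m g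
  sumR-cong zero    f≡g = refl
  sumR-cong (suc m) f≡g = cong₂ _⊕_ (f≡g zero) (sumR-cong m (f≡g ∘ suc))

  dec-true⁻ : ∀ {P : Set} (P? : Dec P) → does P? ≡ true → P
  dec-true⁻ (yes p) _ = p

  module _ {r} {n d : Fin r → ℕ} (φ : (i : Fin r) → Fin (n i) → Fin (d i) → Carrier) where

    halfSpace : Bool → Affine r d → Pred r n
    halfSpace strict f v = does (nonpos? strict (evalA f (λ i → φ i (v i))))

    Monotone-halfSpace : ∀ strict f → Monotone (halfSpace strict f)
    Monotone-halfSpace strict f =
      (λ g h g≗h → cong (λ a → does (nonpos? strict (a ⊕ Affine.const f)))
        (sumR-cong r λ i → cong (u i) (g≗h i))) ,
      Chain-halfSpace strict u (Affine.const f) (halfSpace strict f)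
        (λ g → dec-true⁻ (nonpos? strict _)) (λ g → dec-true (nonpos? strict _))
      where
      -- All coordinates of a vertex enter through this one number, so the dimensions `d i` leave no
      -- trace in the bound.
      u : (i : Fin r) → Fin (n i) → Carrier
      u i x = sumR (d i) (λ j → Affine.coeff f i j R.* φ i x j)

    module _ {s} (B : Basic r d s) where
      open Basic B

      strictAt : Fin s → Bool
      strictAt j = does (p ≤? toℕ j)

      halfSpaces : List (Pred r n)
      halfSpaces = tabulate λ j → halfSpace (strictAt j) (fs j)

      Monotone-halfSpaces : All Monotone halfSpaces
      Monotone-halfSpaces = Allₚ.tabulate⁺ λ j → Monotone-halfSpace (strictAt j) (fs j)

      halfSpaces⇒inBasic : ∀ v → ⋂ halfSpaces v ≡ true → inBasic B (λ i → φ i (v i))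
      halfSpaces⇒inBasic v e j =
        let ≤0 , <0 = Nonpos-does⁻ (p ≤? toℕ j)
                        (dec-true⁻ (nonpos? (strictAt j) _) (⋂-tabulate⁻ s _ v e j))
        in ≤0 ∘ <⇒≱ , <0

      inBasic⇒halfSpaces : ∀ v → inBasic B (λ i → φ i (v i)) → ⋂ halfSpaces v ≡ true
      inBasic⇒halfSpaces v h = ⋂-tabulate⁺ s _ v λ j → dec-true (nonpos? (strictAt j) _)
        (Nonpos-does⁺ (p ≤? toℕ j) (proj₁ (h j) ∘ ≰⇒>) (proj₂ (h j)))

-- Part sizes, binary logarithms and the passage to hypergraphs

≤sumℕ : ∀ m (f : Fin m → ℕ) i → f i ≤ sumℕ m f
≤sumℕ (suc m) f zero    = m≤m+n _ _
≤sumℕ (suc m) f (suc i) = ≤-trans (≤sumℕ m (f ∘ suc) i) (m≤n+m _ (f zero))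

-- There is another part and it is nonempty. The strictness turns N ≤ 2^L into the bound
-- `n i < 2 ^ L` on which the bisection depends.
<sumℕ : ∀ m (f : Fin (2 + m) → ℕ) → (∀ i → 0 < f i) → ∀ i → f i < sumℕ (2 + m) f
<sumℕ m f f>0 zero    = m<m+n (f zero) (≤-trans (f>0 (suc zero)) (≤sumℕ (suc m) (f ∘ suc) zero))
<sumℕ m f f>0 (suc i) = ≤-<-trans (≤sumℕ (suc m) (f ∘ suc) i) (m<n+m _ (f>0 zero))

1≤⌈log₂⌉ : ∀ {n} → 2 ≤ n → 1 ≤ ⌈log₂ n ⌉
1≤⌈log₂⌉ {n} 2≤n = subst (_≤ ⌈log₂ n ⌉) (⌈log₂2^n⌉≡n 1) (⌈log₂⌉-mono-≤ 2≤n)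

n≤2^⌈log₂n⌉ : ∀ n → n ≤ 2 ^ ⌈log₂ n ⌉
n≤2^⌈log₂n⌉ = <-rec (λ n → n ≤ 2 ^ ⌈log₂ n ⌉) step
  where
  open ≤-Reasoning
  step : ∀ n → (∀ {m} → m < n → m ≤ 2 ^ ⌈log₂ m ⌉) → n ≤ 2 ^ ⌈log₂ n ⌉
  step zero          rec = z≤n
  step (suc zero)    rec = m^n>0 2 ⌈log₂ 1 ⌉
  step n@(suc (suc m)) rec = begin
    n                                 ≡⟨ ⌊n/2⌋+⌈n/2⌉≡n n ⟨
    ⌊ n /2⌋ + ⌈ n /2⌉                       ≤⟨ +-monoˡ-≤ ⌈ n /2⌉ (⌊n/2⌋≤⌈n/2⌉ n) ⟩
    ⌈ n /2⌉ + ⌈ n /2⌉                 ≡⟨ cong (⌈ n /2⌉ +_) (+-identityʳ _) ⟨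
    2 * ⌈ n /2⌉                       ≤⟨ *-monoʳ-≤ 2 (rec (⌈n/2⌉<n m)) ⟩
    2 ^ suc ⌈log₂ ⌈ n /2⌉ ⌉           ≡⟨ cong (λ e → 2 ^ suc e) (⌈log₂⌈n/2⌉⌉≡⌈log₂n⌉∸1 n) ⟩
    2 ^ (1 + (⌈log₂ n ⌉ ∸ 1))         ≡⟨ cong (2 ^_) (m+[n∸m]≡n (1≤⌈log₂⌉ {n} (s≤s (s≤s z≤n)))) ⟩
    2 ^ ⌈log₂ n ⌉                     ∎

mainTheorem3 : (ℝ : RealField) → (r s t k : ℕ) → 2 ≤ r →
    ∃ λ (C : ℕ) → (H : Hypergraph r) →
    Semilinear.IsSemilinear ℝ s t H → KFree k H →
    numEdges H ≤ C * numVertices H ^ (r ∸ 1)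
    * ⌈log₂ numVertices H ⌉ ^ (s * (2 ^ (r ∸ 1) ∸ 1))
mainTheorem3 ℝ (suc (suc r)) s t k (s≤s (s≤s z≤n)) with count-boxFree (suc r) s k
-- The factor `t` comes from the union bound over the basic pieces of the semilinear set.
... | C , bound = t * C , edges≤
  where
  open Semilinear ℝ
  open HalfSpaces ℝ
  open ≤-Reasoning

  edges≤ : (H : Hypergraph (2 + r)) → IsSemilinear s t H → KFree k H →
           numEdges H ≤ t * C * numVertices H ^ suc r * ⌈log₂ numVertices H ⌉ ^ (s * (2 ^ suc r ∸ 1))
  edges≤ H (d , φ , X , _ , edge⇔) free with all? (λ i → 0 <? size H i)
  -- An empty part leaves no edges. This case is separate because `size<N` rests on every part being
  -- nonempty.
  ... | no ¬all with ¬∀⟶∃¬ (2 + r) _ (λ i → 0 <? size H i) ¬all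
  ...   | i , ≯0 = ≤-trans (≤-reflexive (count-empty (edge H)
            λ g _ → ¬Fin0 (subst Fin (n≤0⇒n≡0 (≮⇒≥ ≯0)) (g i)))) z≤n
  edges≤ H (d , φ , X , _ , edge⇔) free | yes size>0 = begin
    numEdges H
      -- Each piece lies inside the edge set, so it inherits box-freeness and can be bounded on its
      -- own.
      ≤⟨ count-cover m (λ j → ⋂ (halfSpaces φ (pieces j))) (edge H) _ cover
           (λ j → bound N L (1≤⌈log₂⌉ 2≤N) (λ i → <⇒≤ (size<N i))
             (λ i → ≤-trans (size<N i) (n≤2^⌈log₂n⌉ N))
             (halfSpaces φ (pieces j))
             (Monotone-halfSpaces φ (pieces j))
             (length-tabulate _)
             (BoxFree-⊑ _ (edge H) (covered j) free)) ⟩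
    m * (C * N ^ suc r * E)
      ≤⟨ *-monoˡ-≤ _ m≤t ⟩
    t * (C * N ^ suc r * E)
      ≡⟨ trans (cong (_* E) (*-assoc t C _)) (*-assoc t _ E) ⟨
    t * C * N ^ suc r * E ∎
    where
    open SemilinearSet X
    N = numVertices H
    L = ⌈log₂ N ⌉
    E = L ^ (s * (2 ^ suc r ∸ 1))

    size<N : ∀ i → size H i < N
    size<N = <sumℕ r (size H) size>0

    2≤N : 2 ≤ N
    2≤N = ≤-trans (s≤s (size>0 zero)) (size<N zero)

    cover : ∀ v → edge H v ≡ true → ∃ λ j → ⋂ (halfSpaces φ (pieces j)) v ≡ true
    cover v e with Equivalence.to (edge⇔ v) e
    ... | j , h = j , inBasic⇒halfSpaces φ (pieces j) v h

    covered : ∀ j → ⋂ (halfSpaces φ (pieces j)) ⊑ edge H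
    covered j v e = Equivalence.from (edge⇔ v) (j , halfSpaces⇒inBasic φ (pieces j) v e)
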